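{- Let $a,m$ be integers with $1<a<m$ and $\gcd(a,m)=1$, let $\Lambda(a,m)=\{(x,y)\in\mathbb{Z}\times\mathbb{Z}\mid ax+y\equiv 0 \pmod m\}$, and let $\widehat{v}_i^{(k)}$, $\mathcal{I}_k$, $q_k$ ($0\le k\le N$) be the s-state row vectors, inner products and quotients of Qin's algorithm on input $(a,m)$. Suppose there is an index $k_0$ with $0\le k_0<N$, $\mathcal{I}_{k_0}<0$ and $\mathcal{I}_{k_0+1}\ge 0$. For $0\le k\le N$ put $$D_{k}=q_{k}\mathcal{I}_{k}+\sum_{j=0}^{k-1}(-1)^{k-1-j}(q_{j+1}-q_{j})\mathcal{I}_{j}+(-1)^{k}(a^2+1-m^2),\qquad q_0=0.$$ If $|\mathcal{I}_{k_0}|\ge|\mathcal{I}_{k_0+1}|$, then: (a) when $D_{k_0+1}\ge 0$, $\widehat{v}_{2-\delta_{k_0+1}}^{(k_0+1)}$ is a shortest non-zero vector of $\Lambda(a,m)$; (b) when $D_{k_0+1}\le 0$, $\widehat{v}_{1+\delta_{k_0+1}}^{(k_0+1)}$ is a shortest non-zero vector of $\Lambda(a,m)$. If $|\mathcal{I}_{k_0}|\le|\mathcal{I}_{k_0+1}|$, then: (a) when $D_{k_0}\ge 0$, $\widehat{v}_{2-\delta_{k_0}}^{(k_0)}$ is a shortest non-zero vector of $\Lambda(a,m)$; (b) when $D_{k_0}\le 0$, $\widehat{v}_{1+\delta_{k_0}}^{(k_0)}$ is a shortest non-zero vector of $\Lambda(a,m)$.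
   Context: Lengths are Euclidean: $\|(x,y)\|^2=x^2+y^2$. A shortest non-zero vector of $\Lambda(a,m)$ is a non-zero element of $\Lambda(a,m)$ of minimal length. For an integer $k$, $\delta_k\in\{0,1\}$ is defined by $\delta_k\equiv k\pmod 2$. Qin's algorithm on input $(a,m)$ produces states $\mathcal{X}_k=\begin{pmatrix} x_{11}^{(k)} & x_{12}^{(k)}\\ x_{21}^{(k)} & x_{22}^{(k)}\end{pmatrix}$, starting from $\mathcal{X}_0=\begin{pmatrix}1&a\\0&m\end{pmatrix}$. For $k\ge 1$: - if $k$ is odd, $q_k=\left\lfloor \frac{x_{22}^{(k-1)}-1}{x_{12}^{(k-1)}}\right\rfloor$, $x_{21}^{(k)}=x_{21}^{(k-1)}+q_kx_{11}^{(k-1)}$, $x_{22}^{(k)}=x_{22}^{(k-1)}-q_kx_{12}^{(k-1)}$, and the first row is unchanged; - if $k$ is even, $q_k=\left\lfloor \frac{x_{12}^{(k-1)}-1}{x_{22}^{(k-1)}}\right\rfloor$, $x_{11}^{(k)}=x_{11}^{(k-1)}+q_kx_{21}^{(k-1)}$, $x_{12}^{(k)}=x_{12}^{(k-1)}-q_kx_{22}^{(k-1)}$, and the second row is unchanged. The algorithm terminates as soon as the upper right entry $x_{12}^{(k)}$ equals $1$; $N$ denotes the index of this terminating state. The s-state is $\widehat{\mathcal{X}_k}=\begin{pmatrix} x_{11}^{(k)} & -x_{12}^{(k)}\\ x_{21}^{(k)} & x_{22}^{(k)}\end{pmatrix}$, with row vectors $\widehat{v}_1^{(k)}=(x_{11}^{(k)},-x_{12}^{(k)})$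 and $\widehat{v}_2^{(k)}=(x_{21}^{(k)},x_{22}^{(k)})$. The inner product is $\mathcal{I}_k=\langle\widehat{v}_1^{(k)},\widehat{v}_2^{(k)}\rangle=x_{11}^{(k)}x_{21}^{(k)}-x_{12}^{(k)}x_{22}^{(k)}$, for $0\le k\le N$. -}

module Defs where

open import Data.Integer using (ℤ; 0ℤ; 1ℤ; -1ℤ; _+_; _-_; _*_; -_; _^_; _≤_; ≢-nonZero)
open import Data.Integer.DivMod using (_/_)
open import Data.Integer.Divisibility.Signed using (_∣_)
open import Data.Integer.Properties using (_≟_)
open import Data.Nat using (ℕ; zero; suc; _∸_; _<_; _%_)
open import Data.Product using (_×_; _,_)
open import Relation.Binary.PropositionalEquality using (_≡_; _≢_)
open import Relation.Nullary using (yes; no)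

ℤ² : Set
ℤ² = ℤ × ℤ

⟨_,_⟩ : ℤ² → ℤ² → ℤ
⟨ (x , y) , (x′ , y′) ⟩ = x * x′ + y * y′

‖_‖² : ℤ² → ℤ
‖ (x , y) ‖² = x ^ 2 + y ^ 2

_∈Λ[_,_] : ℤ² → ℤ → ℤ → Set
(x , y) ∈Λ[ a , m ] = m ∣ a * x + y

NonZeroVector : ℤ² → Set
NonZeroVector v = v ≢ (0ℤ , 0ℤ)

-- Lengths are compared through their squares, which order vectors in the same
-- way and stay in ℤ.
record IsShortestNonZero (a m : ℤ) (v : ℤ²) : Set where
  field
    inLattice : v ∈Λ[ a , m ]
    nonZero   : NonZeroVector v
    minimal   : ∀ w → w ∈Λ[ a , m ] → NonZeroVector w → ‖ v ‖² ≤ ‖ w ‖²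

δ : ℕ → ℕ
δ k = k % 2

-- Equal to ⌊ n / d ⌋ for d > 0.  The value at d = 0 is a dummy: on coprime
-- input 1 < a < m both x₁₂ and x₂₂, the only divisors used below, stay
-- positive in every state.
floorDiv : ℤ → ℤ → ℤ
floorDiv n d with d ≟ 0ℤ
... | yes _  = 0ℤ
... | no d≢0 = (n / d) {{≢-nonZero d≢0}}

record State : Set where
  constructor mkState
  field
    x₁₁ x₁₂ x₂₁ x₂₂ : ℤ

open State public

-- In `quotient` and `update` the first argument is δ k, where k is the index
-- of the state being produced: 1 for odd k and 0 for even k.
quotient : ℕ → State → ℤ
quotient 1 X = floorDiv (x₂₂ X - 1ℤ) (x₁₂ X)
quotient _ X = floorDiv (x₁₂ X - 1ℤ) (x₂₂ X)

update : ℕ → ℤ → State → State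
update 1 q (mkState x₁₁ x₁₂ x₂₁ x₂₂) =
  mkState x₁₁             x₁₂
          (x₂₁ + q * x₁₁) (x₂₂ - q * x₁₂)
update _ q (mkState x₁₁ x₁₂ x₂₁ x₂₂) =
  mkState (x₁₁ + q * x₂₁) (x₁₂ - q * x₂₂)
          x₂₁             x₂₂

-- The recursion is continued past termination; `TerminatesAt` singles out the
-- index at which the algorithm stops.
state : ℤ → ℤ → ℕ → State
state a m zero    = mkState 1ℤ a 0ℤ m
state a m (suc k) =
  update (δ (suc k)) (quotient (δ (suc k)) (state a m k)) (state a m k)

q : ℤ → ℤ → ℕ → ℤ
q a m zero    = 0ℤ
q a m (suc k) = quotient (δ (suc k)) (state a m k)

TerminatesAt : ℤ → ℤ → ℕ → Set
TerminatesAt a m N =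
  x₁₂ (state a m N) ≡ 1ℤ × (∀ k → k < N → x₁₂ (state a m k) ≢ 1ℤ)

-- v̂ a m i k is the i-th row of the k-th s-state.  Rows are numbered 1 and 2,
-- and only these values of i are used.
v̂ : ℤ → ℤ → ℕ → ℕ → ℤ²
v̂ a m 1 k = x₁₁ (state a m k) , - x₁₂ (state a m k)
v̂ a m _ k = x₂₁ (state a m k) , x₂₂ (state a m k)

I : ℤ → ℤ → ℕ → ℤ
I a m k = ⟨ v̂ a m 1 k , v̂ a m 2 k ⟩

∑[j<_]_ : ℕ → (ℕ → ℤ) → ℤ
∑[j< zero  ] f = 0ℤ
∑[j< suc n ] f = (∑[j< n ] f) + f n

-- The truncated subtraction is exact, since j < k in every summand.
D : ℤ → ℤ → ℕ → ℤ
D a m k =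
  q a m k * I a m k
  + (∑[j< k ] λ j → -1ℤ ^ (k ∸ 1 ∸ j) * (q a m (suc j) - q a m j) * I a m j)
  + -1ℤ ^ k * (a ^ 2 + 1ℤ - m ^ 2)

{-# OPTIONS --safe #-}
module Submission where

-- Each step turns the rows u, w of the s-state into u′ = u + c w and w, so that
-- ⟨u′, w⟩ = ⟨u, w⟩ + c ‖w‖², and the rows always form a basis of Λ(a, m).  At the
-- sign change, say with |⟨u, w⟩| ≤ |⟨u′, w⟩|, we have 0 ≤ −2⟨u, w⟩ ≤ c ‖w‖².
-- Up to sign a lattice vector is αu + βw with α ≥ 0.  If β ≤ 0 or β ≥ cα it is at
-- least as long as u (or w, when α = 0) by this inequality.  If 0 < β < cα,
-- positivity of the entries of u, u′ and w makes each of its coordinates at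
-- least as large in absolute value as that of w.  The opposite case is the same
-- for the pair u′, −w, with the two coordinates exchanged.  So the shorter row
-- is a shortest vector, and D tells which one it is: up to the sign (−1)ᵏ it is
-- ‖v̂₁‖² − ‖v̂₂‖², by the recursion Dₖ₊₁ = qₖ₊₁ (Iₖ₊₁ + Iₖ) − Dₖ.

open import Defs
open import Data.Integer using (ℤ; +_; 0ℤ; 1ℤ; -1ℤ; ∣_∣; _+_; _-_; _*_; -_; _^_; _<_; _≥_; _≤_; +≤+; nonNegative; ≢-nonZero)
open import Data.Integer.DivMod using ([n/d]*d≤n; 0≤n⇒0≤n/d)
open import Data.Integer.Divisibility.Signed using (divides)
open import Data.Integer.GCD using (gcd)
open import Data.Integer.Properties
open import Data.Integer.Tactic.RingSolver using (solve-∀)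
open import Data.Nat as ℕ using (ℕ; zero; suc; _∸_)
import Data.Nat.Properties as ℕ
open import Data.Product using (_×_; _,_; ∃₂; proj₂)
open import Data.Sum as Sum using (_⊎_; inj₁; inj₂; [_,_]′)
open import Function using (id; _∘_)
open import Relation.Binary.Definitions using (tri<; tri≈; tri>)
open import Relation.Binary.PropositionalEquality using (_≡_; _≢_; refl; sym; trans; cong; cong₂; subst; subst₂)
open import Relation.Nullary using (¬_; yes; no; contradiction)

-- Inequalities over the integers.

private
  variable
    a m c s t x y z : ℤ

infixr 5 _0≤+_
infixr 6 _0≤*_

_0≤+_ : 0ℤ ≤ x → 0ℤ ≤ y → 0ℤ ≤ x + y
_0≤+_ = +-mono-≤

_0≤*_ : 0ℤ ≤ x → 0ℤ ≤ y → 0ℤ ≤ x * y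
_0≤*_ {x} {y} 0≤x 0≤y =
  subst (_≤ x * y) (*-zeroʳ x) (*-monoˡ-≤-nonNeg x {{nonNegative 0≤x}} 0≤y)

0≤1 : 0ℤ ≤ 1ℤ
0≤1 = +≤+ ℕ.z≤n

-x*-x≡x*x : ∀ x → - x * - x ≡ x * x
-x*-x≡x*x = solve-∀

0≤x² : ∀ x → 0ℤ ≤ x * x
0≤x² x with ≤-total 0ℤ x
... | inj₁ 0≤x = 0≤x 0≤* 0≤x
... | inj₂ x≤0 = subst (0ℤ ≤_) (-x*-x≡x*x x) (neg-mono-≤ x≤0 0≤* neg-mono-≤ x≤0)

-- Polynomial inequalities are proved by exhibiting the difference of the two
-- sides as a combination of nonnegative terms.
≤-certificate : ∀ x y → y - x ≡ z → 0ℤ ≤ z → x ≤ y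
≤-certificate x y eq 0≤z = 0≤i-j⇒j≤i (subst (0ℤ ≤_) (sym eq) 0≤z)

<-≤-connex : ∀ x y → x < y ⊎ y ≤ x
<-≤-connex x y with x <? y
... | yes x<y = inj₁ x<y
... | no  x≮y = inj₂ (≮⇒≥ x≮y)

square-mono : ∀ x y → 0ℤ ≤ x → x ≤ y → x * x ≤ y * y
square-mono x y 0≤x x≤y = ≤-certificate (x * x) (y * y) (identity x y)
  (i≤j⇒0≤j-i x≤y 0≤* (i≤j⇒0≤j-i x≤y 0≤+ 0≤x 0≤+ 0≤x))
  where
  identity : ∀ x y → y * y - x * x ≡ (y - x) * ((y - x) + (x + x))
  identity = solve-∀

1≤x² : x ≢ 0ℤ → 1ℤ ≤ x * x
1≤x² {x} x≢0 with <-cmp 0ℤ x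
... | tri< 0<x _ _ = square-mono 1ℤ x 0≤1 (i<j⇒suc[i]≤j 0<x)
... | tri≈ _ 0≡x _ = contradiction (sym 0≡x) x≢0
... | tri> _ _ x<0 = subst (1ℤ ≤_) (-x*-x≡x*x x)
                       (square-mono 1ℤ (- x) 0≤1 (i<j⇒suc[i]≤j (neg-mono-< x<0)))

-- Minimum of a binary quadratic form.

-- The squared length of αu + βw, where `U` = ‖u‖², `J` = ⟨u, w⟩ and `W` = ‖w‖².
form : ℤ → ℤ → ℤ → ℤ → ℤ → ℤ
form U J W α β = α * α * U + (α * β * J + α * β * J) + β * β * W

-- For c > 0 these are the integer combinations αu + βw strictly inside the cone between u and u + c
-- w.
Strip : ℤ → (ℤ → ℤ → Set) → Set
Strip c P = ∀ α β → 1ℤ ≤ α → 1ℤ ≤ β → 1ℤ + β ≤ c * α → P α β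

module _ {c U J W : ℤ}
  (0≤U : 0ℤ ≤ U) (J≤0 : J ≤ 0ℤ) (0≤W : 0ℤ ≤ W) (0≤cW+2J : 0ℤ ≤ c * W + (J + J))
  (strip : Strip c (λ α β → W ≤ form U J W α β))
  where

  form-minimum⁺ : ∀ α β → 1ℤ ≤ α → U ≤ form U J W α β ⊎ W ≤ form U J W α β
  form-minimum⁺ α β 1≤α with <-≤-connex 0ℤ β | <-≤-connex β (c * α)
  ... | inj₂ β≤0 | _ = inj₁ (≤-certificate _ _ (identity U J W α β)
      (i≤j⇒0≤j-i 1≤α 0≤* (0≤α 0≤+ 0≤1) 0≤* 0≤U
        0≤+ (0≤α 0≤* (neg-mono-≤ β≤0 0≤* neg-mono-≤ J≤0))
        0≤+ (0≤α 0≤* (neg-mono-≤ β≤0 0≤* neg-mono-≤ J≤0))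
        0≤+ 0≤x² β 0≤* 0≤W))
    where
    0≤α : 0ℤ ≤ α
    0≤α = ≤-trans 0≤1 1≤α
    identity : ∀ U J W α β → α * α * U + (α * β * J + α * β * J) + β * β * W - U ≡
      (α - 1ℤ) * ((α + 1ℤ) * U) +
      (α * (- β * - J) + (α * (- β * - J) + β * β * W))
    identity = solve-∀
  -- The terms with β group as β²W + 2αβJ = β ((β - cα) W + α (cW + 2J)), nonnegative here.
  ... | inj₁ 0<β | inj₂ cα≤β = inj₁ (≤-certificate _ _ (identity c U J W α β)
      (i≤j⇒0≤j-i 1≤α 0≤* (0≤α 0≤+ 0≤1) 0≤* 0≤U
        0≤+ <⇒≤ 0<β 0≤* (i≤j⇒0≤j-i cα≤β 0≤* 0≤W 0≤+ 0≤α 0≤* 0≤cW+2J)))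
    where
    0≤α : 0ℤ ≤ α
    0≤α = ≤-trans 0≤1 1≤α
    identity : ∀ c U J W α β → α * α * U + (α * β * J + α * β * J) + β * β * W - U ≡
      (α - 1ℤ) * ((α + 1ℤ) * U) +
      β * ((β - c * α) * W + α * (c * W + (J + J)))
    identity = solve-∀
  ... | inj₁ 0<β | inj₁ β<cα =
    inj₂ (strip α β 1≤α (i<j⇒suc[i]≤j 0<β) (i<j⇒suc[i]≤j β<cα))

  -- The form is even in (α, β), so a negative α reduces to a positive one; for α = 0 only β²W
  -- remains, with β² ≥ 1.
  form-minimum : ∀ α β → ¬ (α ≡ 0ℤ × β ≡ 0ℤ) →
    U ≤ form U J W α β ⊎ W ≤ form U J W α β
  form-minimum α β αβ≢0 with <-cmp 0ℤ α
  ... | tri< 0<α _ _ = form-minimum⁺ α β (i<j⇒suc[i]≤j 0<α)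
  ... | tri≈ _ refl _ = inj₂ (≤-certificate _ _ (identity U J W β)
      (i≤j⇒0≤j-i (1≤x² λ β≡0 → αβ≢0 (refl , β≡0)) 0≤* 0≤W))
    where
    identity : ∀ U J W β →
      0ℤ * 0ℤ * U + (0ℤ * β * J + 0ℤ * β * J) + β * β * W - W ≡ (β * β - 1ℤ) * W
    identity = solve-∀
  ... | tri> _ _ α<0 = subst (λ V → U ≤ V ⊎ W ≤ V) (identity U J W α β)
      (form-minimum⁺ (- α) (- β) (i<j⇒suc[i]≤j (neg-mono-< α<0)))
    where
    identity : ∀ U J W α β →
      - α * - α * U + (- α * - β * J + - α * - β * J) + - β * - β * W ≡
      α * α * U + (α * β * J + α * β * J) + β * β * W
    identity = solve-∀

-- Coordinatewise comparison inside the strip.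

-- s and t stand for matching coordinates of u and w.
record Dominates (c s t : ℤ) : Set where
  field
    t²≤ : Strip c λ α β → t * t ≤ (α * s + β * t) * (α * s + β * t)

open Dominates

dominates-agreeing : 0ℤ ≤ s → 0ℤ ≤ t → Dominates c s t
t²≤ (dominates-agreeing {s} {t} 0≤s 0≤t) α β 1≤α 1≤β _ = square-mono t (α * s + β * t) 0≤t
  (≤-certificate _ _ (identity s t α β) (≤-trans 0≤1 1≤α 0≤* 0≤s 0≤+ i≤j⇒0≤j-i 1≤β 0≤* 0≤t))
  where
  identity : ∀ s t α β → α * s + β * t - t ≡ α * s + (β - 1ℤ) * t
  identity = solve-∀

-- The number s - ct is the matching coordinate of u′ = u + c w. In αs - βt = α (s - ct) + (cα - β)
-- t the first term is nonnegative and cα - β ≥ 1.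
dominates-opposing : 0ℤ ≤ t → c * t ≤ s → Dominates c s (- t)
t²≤ (dominates-opposing {t} {c} {s} 0≤t ct≤s) α β 1≤α _ β<cα =
  subst (_≤ (α * s + β * - t) * (α * s + β * - t)) (sym (-x*-x≡x*x t)) (square-mono t (α * s + β * - t) 0≤t
    (≤-certificate _ _ (identity c s t α β)
      (≤-trans 0≤1 1≤α 0≤* i≤j⇒0≤j-i ct≤s 0≤+ i≤j⇒0≤j-i β<cα 0≤* 0≤t)))
  where
  identity : ∀ c s t α β →
    α * s + β * - t - t ≡ α * (s - c * t) + (c * α - (1ℤ + β)) * t
  identity = solve-∀

dominates-neg : Dominates c s t → Dominates c (- s) (- t)
t²≤ (dominates-neg {c} {s} {t} dom) α β 1≤α 1≤β β<cα =
  subst₂ _≤_ (sym (-x*-x≡x*x t)) (identity s t α β) (t²≤ dom α β 1≤α 1≤β β<cα)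
  where
  identity : ∀ s t α β → (α * s + β * t) * (α * s + β * t) ≡
    (α * - s + β * - t) * (α * - s + β * - t)
  identity = solve-∀

-- Vectors and bases of the lattice.

infixl 6 _⊕_
infixl 7 _·_

_⊕_ : ℤ² → ℤ² → ℤ²
(x , y) ⊕ (x′ , y′) = x + x′ , y + y′

_·_ : ℤ → ℤ² → ℤ²
c · (x , y) = c * x , c * y

⊖_ : ℤ² → ℤ²
⊖ (x , y) = - x , - y

⊕-comm : ∀ u w → u ⊕ w ≡ w ⊕ u
⊕-comm (x , y) (x′ , y′) = cong₂ _,_ (+-comm x x′) (+-comm y y′)

-- The ring solver does not read _^_, so below squares coming from ‖_‖² appear
-- in their unfolded form x * (x * 1ℤ).
‖‖²≡x*x+y*y : ∀ x y → ‖ (x , y) ‖² ≡ x * x + y * y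
‖‖²≡x*x+y*y = identity
  where
  identity : ∀ x y → x * (x * 1ℤ) + y * (y * 1ℤ) ≡ x * x + y * y
  identity = solve-∀

0≤‖‖² : ∀ v → 0ℤ ≤ ‖ v ‖²
0≤‖‖² (x , y) = subst (0ℤ ≤_) (sym (‖‖²≡x*x+y*y x y)) (0≤x² x 0≤+ 0≤x² y)

‖⊖‖² : ∀ v → ‖ ⊖ v ‖² ≡ ‖ v ‖²
‖⊖‖² (x , y) = identity x y
  where
  identity : ∀ x y → - x * (- x * 1ℤ) + - y * (- y * 1ℤ) ≡ x * (x * 1ℤ) + y * (y * 1ℤ)
  identity = solve-∀

‖α·u⊕β·w‖² : ∀ u w α β → ‖ α · u ⊕ β · w ‖² ≡ form ‖ u ‖² ⟨ u , w ⟩ ‖ w ‖² α β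
‖α·u⊕β·w‖² (x , y) (x′ , y′) = identity x y x′ y′
  where
  identity : ∀ x y x′ y′ α β →
    (α * x + β * x′) * ((α * x + β * x′) * 1ℤ) + (α * y + β * y′) * ((α * y + β * y′) * 1ℤ) ≡
    α * α * (x * (x * 1ℤ) + y * (y * 1ℤ))
    + (α * β * (x * x′ + y * y′) + α * β * (x * x′ + y * y′))
    + β * β * (x′ * (x′ * 1ℤ) + y′ * (y′ * 1ℤ))
  identity = solve-∀

record Basis (a m : ℤ) (u w : ℤ²) : Set where
  field
    u∈Λ  : u ∈Λ[ a , m ]
    w∈Λ  : w ∈Λ[ a , m ]
    span : ∀ v → v ∈Λ[ a , m ] → ∃₂ λ α β → v ≡ α · u ⊕ β · w

open Basis

-- Leaves open which of u and w is the shorter one; the sign of `D` decides that later.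
record Shorter (a m : ℤ) (u w : ℤ²) : Set where
  field
    bound : ∀ v → v ∈Λ[ a , m ] → NonZeroVector v → ‖ u ‖² ≤ ‖ v ‖² ⊎ ‖ w ‖² ≤ ‖ v ‖²

open Shorter

shorter-swap : ∀ {u w} → Shorter a m u w → Shorter a m w u
bound (shorter-swap sh) v v∈Λ v≢0 = Sum.swap (bound sh v v∈Λ v≢0)

shorter⇒shortest : ∀ {u w} → Shorter a m u w → u ∈Λ[ a , m ] → NonZeroVector u →
  ‖ u ‖² ≤ ‖ w ‖² → IsShortestNonZero a m u
shorter⇒shortest sh u∈Λ u≢0 u≤w = record
  { inLattice = u∈Λ
  ; nonZero   = u≢0
  ; minimal   = λ v v∈Λ v≢0 → [ id , ≤-trans u≤w ]′ (bound sh v v∈Λ v≢0)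
  }

basis-swap : ∀ {u w} → Basis a m u w → Basis a m w u
basis-swap {u = u} {w} B = record
  { u∈Λ  = w∈Λ B
  ; w∈Λ  = u∈Λ B
  ; span = λ v v∈Λ → let α , β , v≡ = span B v v∈Λ in
      β , α , trans v≡ (⊕-comm (α · u) (β · w))
  }

basis-neg : ∀ {u w} → Basis a m u w → Basis a m u (⊖ w)
basis-neg {a} {m} {u} {w = x , y} B = record
  { u∈Λ  = u∈Λ B
  ; w∈Λ  = neg (w∈Λ B)
  ; span = λ v v∈Λ → let α , β , v≡ = span B v v∈Λ in
      α , - β , trans v≡ (cong (α · u ⊕_) (cong₂ _,_ (identity β x) (identity β y)))
  }
  where
  neg : (x , y) ∈Λ[ a , m ] → (- x , - y) ∈Λ[ a , m ]
  neg (divides k eq) = divides (- k) (trans (pull a x y) (trans (cong -_ eq) (neg-distribˡ-* k m)))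
    where
    pull : ∀ a x y → a * - x + - y ≡ - (a * x + y)
    pull = solve-∀
  identity : ∀ β x → β * x ≡ - β * - x
  identity = solve-∀

basis-shear : ∀ c {u w} → Basis a m u w → Basis a m (u ⊕ c · w) w
basis-shear {a} {m} c {x , y} {x′ , y′} B = record
  { u∈Λ  = shear (u∈Λ B) (w∈Λ B)
  ; w∈Λ  = w∈Λ B
  ; span = λ v v∈Λ → let α , β , v≡ = span B v v∈Λ in
      α , β - α * c , trans v≡ (cong₂ _,_ (identity c α β x x′) (identity c α β y y′))
  }
  where
  shear : (x , y) ∈Λ[ a , m ] → (x′ , y′) ∈Λ[ a , m ] →
    (x + c * x′ , y + c * y′) ∈Λ[ a , m ]
  shear (divides k eq) (divides k′ eq′) = divides (k + c * k′)
    (trans (pull a c x y x′ y′) (trans (cong₂ (λ s t → s + c * t) eq eq′) (push c k k′ m)))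
    where
    pull : ∀ a c x y x′ y′ → a * (x + c * x′) + (y + c * y′) ≡ (a * x + y) + c * (a * x′ + y′)
    pull = solve-∀
    push : ∀ c k k′ m → k * m + c * (k′ * m) ≡ (k + c * k′) * m
    push = solve-∀
  identity : ∀ c α β x x′ → α * x + β * x′ ≡ α * (x + c * x′) + (β - α * c) * x′
  identity = solve-∀

initial-basis : ∀ a m → Basis a m (1ℤ , - a) (0ℤ , m)
initial-basis a m = record
  { u∈Λ  = divides 0ℤ (first a m)
  ; w∈Λ  = divides 1ℤ (second a m)
  -- The congruence ax + y = km gives y = -ax + km, so the coefficients are x and k.
  ; span = λ { (x , y) (divides k eq) → x , k ,
      cong₂ _,_ (left x k) (trans (right a x y) (cong (λ n → x * - a + n) eq)) }
  }
  where
  first : ∀ a m → a * 1ℤ + - a ≡ 0ℤ * m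
  first = solve-∀
  second : ∀ a m → a * 0ℤ + m ≡ 1ℤ * m
  second = solve-∀
  left : ∀ x k → x ≡ x * 1ℤ + k * 0ℤ
  left = solve-∀
  right : ∀ a x y → y ≡ x * - a + (a * x + y)
  right = solve-∀

reduced⇒shorter : ∀ c {u₁ u₂ w₁ w₂} → let u = u₁ , u₂; w = w₁ , w₂ in
  Basis a m u w → ⟨ u , w ⟩ ≤ 0ℤ → 0ℤ ≤ c * ‖ w ‖² + (⟨ u , w ⟩ + ⟨ u , w ⟩) →
  Dominates c u₁ w₁ → Dominates c u₂ w₂ → Shorter a m u w
bound (reduced⇒shorter c {u₁} {u₂} {w₁} {w₂} B J≤0 0≤cW+2J dom₁ dom₂) v v∈Λ v≢0
  with α , β , refl ← span B v v∈Λ =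
  subst (λ V → ‖ u ‖² ≤ V ⊎ ‖ w ‖² ≤ V) (sym (‖α·u⊕β·w‖² u w α β))
    (form-minimum {c} (0≤‖‖² u) J≤0 (0≤‖‖² w) 0≤cW+2J strip α β
      λ { (refl , refl) → v≢0 refl })
  where
  u w : ℤ²
  u = u₁ , u₂
  w = w₁ , w₂
  strip : Strip c (λ α β → ‖ w ‖² ≤ form ‖ u ‖² ⟨ u , w ⟩ ‖ w ‖² α β)
  strip α β 1≤α 1≤β β<cα = subst₂ _≤_ (sym (‖‖²≡x*x+y*y w₁ w₂))
    (trans (sym (‖‖²≡x*x+y*y (α * u₁ + β * w₁) (α * u₂ + β * w₂))) (‖α·u⊕β·w‖² u w α β))
    (+-mono-≤ (t²≤ dom₁ α β 1≤α 1≤β β<cα) (t²≤ dom₂ α β 1≤α 1≤β β<cα))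

-- Invariants of the states.

floorDiv-nonNeg : ∀ n d → 0ℤ ≤ n → 0ℤ ≤ d → 0ℤ ≤ floorDiv n d
floorDiv-nonNeg n d 0≤n 0≤d with d ≟ 0ℤ
... | yes _  = ≤-refl
... | no d≢0 = 0≤n⇒0≤n/d n d {{≢-nonZero d≢0}} 0≤n 0≤d

floorDiv*d≤n : ∀ n d → 0ℤ ≤ n → floorDiv n d * d ≤ n
floorDiv*d≤n n d 0≤n with d ≟ 0ℤ
... | yes _  = 0≤n
... | no d≢0 = [n/d]*d≤n n d {{≢-nonZero d≢0}}

row₁ row₂ : State → ℤ²
row₁ X = x₁₁ X , - x₁₂ X
row₂ X = x₂₁ X , x₂₂ X

inner : State → ℤ
inner X = ⟨ row₁ X , row₂ X ⟩

-- The signs of the entries give the domination of coordinates; the bounds by 1 also make both rows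
-- non-zero.
record Valid (a m : ℤ) (X : State) : Set where
  field
    0≤x₁₁ : 0ℤ ≤ x₁₁ X
    1≤x₁₂ : 1ℤ ≤ x₁₂ X
    0≤x₂₁ : 0ℤ ≤ x₂₁ X
    1≤x₂₂ : 1ℤ ≤ x₂₂ X
    basis : Basis a m (row₁ X) (row₂ X)

open Valid

-- This is why the quotients are floors of (n - 1) / d and not of n / d: the new entry stays at
-- least 1.
1≤n-c*d : ∀ c d n → c * d ≤ n - 1ℤ → 1ℤ ≤ n - c * d
1≤n-c*d c d n c*d≤n-1 = ≤-certificate _ _ (identity c d n) (i≤j⇒0≤j-i c*d≤n-1)
  where
  identity : ∀ c d n → n - c * d - 1ℤ ≡ n - 1ℤ - c * d
  identity = solve-∀

step₀ step₁ : State → State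
step₀ X = update 0 (quotient 0 X) X
step₁ X = update 1 (quotient 1 X) X

step₁-valid : ∀ {X} → Valid a m X → Valid a m (step₁ X)
step₁-valid {a} {m} {X} V = record
  { 0≤x₁₁ = 0≤x₁₁ V
  ; 1≤x₁₂ = 1≤x₁₂ V
  ; 0≤x₂₁ = 0≤x₂₁ V 0≤+
      floorDiv-nonNeg _ (x₁₂ X) (i≤j⇒0≤j-i (1≤x₂₂ V)) (≤-trans 0≤1 (1≤x₁₂ V)) 0≤* 0≤x₁₁ V
  ; 1≤x₂₂ = 1≤n-c*d k (x₁₂ X) (x₂₂ X) (floorDiv*d≤n _ (x₁₂ X) (i≤j⇒0≤j-i (1≤x₂₂ V)))
  -- An odd step changes the second row while `basis-shear` changes the first vector, hence the two
  -- swaps.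
  ; basis = subst (Basis a m (row₁ X)) (cong (x₂₁ X + k * x₁₁ X ,_) (identity k (x₁₂ X) (x₂₂ X)))
      (basis-swap (basis-shear k (basis-swap (basis V))))
  }
  where
  k = quotient 1 X
  identity : ∀ c x y → y + c * - x ≡ y - c * x
  identity = solve-∀

step₀-valid : ∀ {X} → Valid a m X → Valid a m (step₀ X)
step₀-valid {a} {m} {X} V = record
  { 0≤x₁₁ = 0≤x₁₁ V 0≤+
      floorDiv-nonNeg _ (x₂₂ X) (i≤j⇒0≤j-i (1≤x₁₂ V)) (≤-trans 0≤1 (1≤x₂₂ V)) 0≤* 0≤x₂₁ V
  ; 1≤x₁₂ = 1≤n-c*d k (x₂₂ X) (x₁₂ X) (floorDiv*d≤n _ (x₂₂ X) (i≤j⇒0≤j-i (1≤x₁₂ V)))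
  ; 0≤x₂₁ = 0≤x₂₁ V
  ; 1≤x₂₂ = 1≤x₂₂ V
  ; basis = subst (λ u → Basis a m u (row₂ X))
      (cong (x₁₁ X + k * x₂₁ X ,_) (identity k (x₂₂ X) (x₁₂ X)))
      (basis-shear k (basis V))
  }
  where
  k = quotient 0 X
  identity : ∀ c x y → - y + c * x ≡ - (y - c * x)
  identity = solve-∀

-- The two states around the sign change.

c*t≤s+c*t : ∀ c s t → 0ℤ ≤ s → c * t ≤ s + c * t
c*t≤s+c*t c s t 0≤s = ≤-certificate (c * t) _ (identity c s t) 0≤s
  where
  identity : ∀ c s t → s + c * t - c * t ≡ s
  identity = solve-∀

c*t≤s : ∀ c s t → 1ℤ ≤ s - c * t → c * t ≤ s
c*t≤s c s t 1≤s-ct = 0≤i-j⇒j≤i (≤-trans 0≤1 1≤s-ct)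

shorter-neg : ∀ {u w} → Shorter a m u (⊖ w) → Shorter a m u w
bound (shorter-neg {w = w} sh) v v∈Λ v≢0 =
  Sum.map₂ (subst (_≤ ‖ v ‖²) (‖⊖‖² w)) (bound sh v v∈Λ v≢0)

ShorterRows : ℤ → ℤ → State → Set
ShorterRows a m X = Shorter a m (row₁ X) (row₂ X)

-- Here u is `row₂ X` and w is `row₁ X`. Their first coordinates agree in sign; the second ones, t
-- and -r, are opposite, and t - kr ≥ 1 holds after the step.
before₁ : ∀ {X} → Valid a m X →
  inner X ≤ 0ℤ → 0ℤ ≤ inner (step₁ X) + inner X → ShorterRows a m X
before₁ {X = X@(mkState p r s t)} V J≤0 0≤J′+J = shorter-swap (reduced⇒shorter k
  (basis-swap (basis V))
  (subst (_≤ 0ℤ) (J≡ p r s t) J≤0)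
  (subst (0ℤ ≤_) (sum≡ k p r s t) 0≤J′+J)
  (dominates-agreeing (0≤x₂₁ V) (0≤x₁₁ V))
  (dominates-opposing (≤-trans 0≤1 (1≤x₁₂ V)) (c*t≤s k t r (1≤x₂₂ V′))))
  where
  k = quotient 1 X
  V′ = step₁-valid V
  J≡ : ∀ p r s t → p * s + - r * t ≡ s * p + t * - r
  J≡ = solve-∀
  sum≡ : ∀ c p r s t → (p * (s + c * p) + - r * (t - c * r)) + (p * s + - r * t) ≡
    c * (p * (p * 1ℤ) + - r * (- r * 1ℤ)) + ((s * p + t * - r) + (s * p + t * - r))
  sum≡ = solve-∀

-- The step is undone: the old second row is the new one plus k times -`row₁ X`. With w = -`row₁ X`
-- the first coordinates are now the opposing ones and the second ones agree.
after₁ : ∀ {X} → Valid a m X →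
  0ℤ ≤ inner (step₁ X) → inner (step₁ X) + inner X ≤ 0ℤ → ShorterRows a m (step₁ X)
after₁ {X = X@(mkState p r s t)} V 0≤J′ J′+J≤0 = shorter-swap (shorter-neg (reduced⇒shorter k
  (basis-neg (basis-swap (basis V′)))
  (subst (_≤ 0ℤ) (J≡ p r (s + k * p) (t - k * r)) (neg-mono-≤ 0≤J′))
  (subst (0ℤ ≤_) (sum≡ k p r s t) (neg-mono-≤ J′+J≤0))
  (dominates-opposing (0≤x₁₁ V) (c*t≤s+c*t k s p (0≤x₂₁ V)))
  (dominates-agreeing (≤-trans 0≤1 (1≤x₂₂ V′))
    (subst (0ℤ ≤_) (sym (neg-involutive r)) (≤-trans 0≤1 (1≤x₁₂ V))))))
  where
  k = quotient 1 X
  V′ = step₁-valid V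
  J≡ : ∀ p r s t → - (p * s + - r * t) ≡ s * - p + t * - - r
  J≡ = solve-∀
  sum≡ : ∀ c p r s t → - ((p * (s + c * p) + - r * (t - c * r)) + (p * s + - r * t)) ≡
    c * (- p * (- p * 1ℤ) + - - r * (- - r * 1ℤ))
    + (((s + c * p) * - p + (t - c * r) * - - r) + ((s + c * p) * - p + (t - c * r) * - - r))
  sum≡ = solve-∀

before₀ : ∀ {X} → Valid a m X →
  inner X ≤ 0ℤ → 0ℤ ≤ inner (step₀ X) + inner X → ShorterRows a m X
before₀ {X = X@(mkState p r s t)} V J≤0 0≤J′+J = reduced⇒shorter k
  (basis V)
  J≤0
  (subst (0ℤ ≤_) (sum≡ k p r s t) 0≤J′+J)
  (dominates-agreeing (0≤x₁₁ V) (0≤x₂₁ V))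
  -- The second coordinates are -r and t, so domination is shown for r and -t and both signs are
  -- flipped.
  (subst (Dominates k (- r)) (neg-involutive t)
    (dominates-neg (dominates-opposing (≤-trans 0≤1 (1≤x₂₂ V)) (c*t≤s k r t (1≤x₁₂ V′)))))
  where
  k = quotient 0 X
  V′ = step₀-valid V
  sum≡ : ∀ c p r s t → ((p + c * s) * s + - (r - c * t) * t) + (p * s + - r * t) ≡
    c * (s * (s * 1ℤ) + t * (t * 1ℤ)) + ((p * s + - r * t) + (p * s + - r * t))
  sum≡ = solve-∀

-- The even step is undone in the same way, with u the new first row and w = -`row₂ X`.
after₀ : ∀ {X} → Valid a m X →
  0ℤ ≤ inner (step₀ X) → inner (step₀ X) + inner X ≤ 0ℤ → ShorterRows a m (step₀ X)
after₀ {X = X@(mkState p r s t)} V 0≤J′ J′+J≤0 = shorter-neg (reduced⇒shorter k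
  (basis-neg (basis V′))
  (subst (_≤ 0ℤ) (J≡ (p + k * s) (r - k * t) s t) (neg-mono-≤ 0≤J′))
  (subst (0ℤ ≤_) (sum≡ k p r s t) (neg-mono-≤ J′+J≤0))
  (dominates-opposing (0≤x₂₁ V) (c*t≤s+c*t k p s (0≤x₁₁ V)))
  (dominates-neg (dominates-agreeing (≤-trans 0≤1 (1≤x₁₂ V′)) (≤-trans 0≤1 (1≤x₂₂ V)))))
  where
  k = quotient 0 X
  V′ = step₀-valid V
  J≡ : ∀ p r s t → - (p * s + - r * t) ≡ p * - s + - r * - t
  J≡ = solve-∀
  sum≡ : ∀ c p r s t → - (((p + c * s) * s + - (r - c * t) * t) + (p * s + - r * t)) ≡
    c * (- s * (- s * 1ℤ) + - t * (- t * 1ℤ))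
    + (((p + c * s) * - s + - (r - c * t) * - t) + ((p + c * s) * - s + - (r - c * t) * - t))
  sum≡ = solve-∀

-- Validity of all states and the choice between the two.

parity : ∀ k → (δ k ≡ 0 × δ (suc k) ≡ 1) ⊎ (δ k ≡ 1 × δ (suc k) ≡ 0)
parity zero          = inj₁ (refl , refl)
parity (suc zero)    = inj₂ (refl , refl)
parity (suc (suc k)) = parity k

state-valid : ∀ a m → 1ℤ < a → a < m → ∀ k → Valid a m (state a m k)
state-valid a m 1<a a<m zero = record
  { 0≤x₁₁ = 0≤1
  ; 1≤x₁₂ = <⇒≤ 1<a
  ; 0≤x₂₁ = ≤-refl
  ; 1≤x₂₂ = <⇒≤ (<-trans 1<a a<m)
  ; basis = initial-basis a m
  }
state-valid a m 1<a a<m (suc k) with state-valid a m 1<a a<m k | parity k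
... | V | inj₁ (_ , δ≡1) rewrite δ≡1 = step₁-valid V
... | V | inj₂ (_ , δ≡0) rewrite δ≡0 = step₀-valid V

-- Since |x| = -x and |y| = y, comparing absolute values amounts to the sign of y + x. For inner
-- products J and J′ = J + cW this sum is the quantity cW + 2J of `form-minimum`.
ordered-sum-sign : ∀ x y → x ≤ 0ℤ → 0ℤ ≤ y →
  (∣ x ∣ ℕ.≤ ∣ y ∣ → 0ℤ ≤ y + x) × (∣ x ∣ ℕ.≥ ∣ y ∣ → y + x ≤ 0ℤ)
ordered-sum-sign x y x≤0 0≤y = lower , upper
  where
  ∣y∣≡y : + ∣ y ∣ ≡ y
  ∣y∣≡y = 0≤i⇒+∣i∣≡i 0≤y
  ∣x∣≡-x : + ∣ x ∣ ≡ - x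
  ∣x∣≡-x = trans (cong +_ (sym (∣-i∣≡∣i∣ x))) (0≤i⇒+∣i∣≡i (neg-mono-≤ x≤0))
  lower : ∣ x ∣ ℕ.≤ ∣ y ∣ → 0ℤ ≤ y + x
  lower ∣x∣≤∣y∣ = subst (λ z → 0ℤ ≤ y + z) (neg-involutive x)
    (i≤j⇒0≤j-i (subst₂ _≤_ ∣x∣≡-x ∣y∣≡y (+≤+ ∣x∣≤∣y∣)))
  upper : ∣ x ∣ ℕ.≥ ∣ y ∣ → y + x ≤ 0ℤ
  upper ∣y∣≤∣x∣ = subst (λ z → y + z ≤ 0ℤ) (neg-involutive x)
    (i≤j⇒i-j≤0 (subst₂ _≤_ ∣y∣≡y ∣x∣≡-x (+≤+ ∣y∣≤∣x∣)))

crossing-shorter : ∀ a m → 1ℤ < a → a < m → ∀ k → I a m k ≤ 0ℤ → 0ℤ ≤ I a m (suc k) →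
  (∣ I a m k ∣ ℕ.≥ ∣ I a m (suc k) ∣ → ShorterRows a m (state a m (suc k))) ×
  (∣ I a m k ∣ ℕ.≤ ∣ I a m (suc k) ∣ → ShorterRows a m (state a m k))
crossing-shorter a m 1<a a<m k Iₖ≤0 0≤Iₖ₊₁
  with state-valid a m 1<a a<m k | ordered-sum-sign _ _ Iₖ≤0 0≤Iₖ₊₁ | parity k
... | V | below , above | inj₁ (_ , δ≡1) rewrite δ≡1 =
  (after₁ V 0≤Iₖ₊₁ ∘ above) , (before₁ V Iₖ≤0 ∘ below)
... | V | below , above | inj₂ (_ , δ≡0) rewrite δ≡0 =
  (after₀ V 0≤Iₖ₊₁ ∘ above) , (before₀ V Iₖ≤0 ∘ below)

-- `D` as a difference of squared lengths.

∑-neg : ∀ n {f g : ℕ → ℤ} → (∀ j → j ℕ.< n → f j ≡ - g j) → ∑[j< n ] f ≡ - (∑[j< n ] g)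
∑-neg zero    f≡-g = refl
∑-neg (suc n) {f} {g} f≡-g = trans
  (cong₂ _+_ (∑-neg n (λ j j<n → f≡-g j (ℕ.m<n⇒m<1+n j<n))) (f≡-g n ℕ.≤-refl))
  (sym (neg-distrib-+ (∑[j< n ] g) (g n)))

-- Passing to k + 1 flips the sign of every summand with j < k and of the final term. The new
-- summand j = k splits into qₖ₊₁ Iₖ and -qₖ Iₖ, the latter being the leading term of `D a m k`
-- negated.
D-suc : ∀ a m k → D a m (suc k) ≡ q a m (suc k) * (I a m (suc k) + I a m k) - D a m k
D-suc a m k = trans
  (cong (λ σ → q a m (suc k) * I a m (suc k) + σ + - 1ℤ * -1ℤ ^ k * e)
    (cong₂ _+_ (∑-neg k flip) last))
  (identity (q a m k) (q a m (suc k)) (I a m k) (I a m (suc k)) (∑[j< k ] summand k) (-1ℤ ^ k) e)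
  where
  e : ℤ
  e = a ^ 2 + 1ℤ - m ^ 2
  summand : ℕ → ℕ → ℤ
  summand n j = -1ℤ ^ (n ∸ 1 ∸ j) * (q a m (suc j) - q a m j) * I a m j
  pull : ∀ p r s → - 1ℤ * p * r * s ≡ - (p * r * s)
  pull = solve-∀
  flip : ∀ j → j ℕ.< k → summand (suc k) j ≡ - summand k j
  flip j j<k = trans
    (cong (λ n → -1ℤ ^ n * (q a m (suc j) - q a m j) * I a m j) (k∸j≡ k j<k))
    (pull (-1ℤ ^ (k ∸ 1 ∸ j)) (q a m (suc j) - q a m j) (I a m j))
    where
    k∸j≡ : ∀ k → j ℕ.< k → k ∸ j ≡ suc (k ∸ 1 ∸ j)
    k∸j≡ (suc k) j<1+k = ℕ.+-∸-assoc 1 (ℕ.s≤s⁻¹ j<1+k)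
  last : summand (suc k) k ≡ 1ℤ * (q a m (suc k) - q a m k) * I a m k
  last = cong (λ n → -1ℤ ^ n * (q a m (suc k) - q a m k) * I a m k) (ℕ.n∸n≡0 k)
  identity : ∀ p p′ i i′ σ ε e →
    p′ * i′ + (- σ + 1ℤ * (p′ - p) * i) + - 1ℤ * ε * e ≡
    p′ * (i′ + i) - (p * i + σ + ε * e)
  identity = solve-∀

-- The first argument is the parity of the index. For k ≥ 1 the row changed by step k comes first
-- and the unchanged row is subtracted.
gap : ℕ → State → ℤ
gap 1 X = ‖ row₂ X ‖² - ‖ row₁ X ‖²
gap _ X = ‖ row₁ X ‖² - ‖ row₂ X ‖²

-- For u′ = u + c w one has ‖u′‖² - ‖u‖² = ⟨u′ - u, u′ + u⟩ = c (⟨u′, w⟩ + ⟨u, w⟩); subtracting ‖w‖²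
-- - ‖u‖² leaves ‖u′‖² - ‖w‖².
gap-update₁ : ∀ c X → c * (inner (update 1 c X) + inner X) - gap 0 X ≡ gap 1 (update 1 c X)
gap-update₁ c (mkState p r s t) = identity c p r s t
  where
  identity : ∀ c p r s t →
    c * ((p * (s + c * p) + - r * (t - c * r)) + (p * s + - r * t))
    - ((p * (p * 1ℤ) + - r * (- r * 1ℤ)) - (s * (s * 1ℤ) + t * (t * 1ℤ))) ≡
    ((s + c * p) * ((s + c * p) * 1ℤ) + (t - c * r) * ((t - c * r) * 1ℤ))
    - (p * (p * 1ℤ) + - r * (- r * 1ℤ))
  identity = solve-∀

gap-update₀ : ∀ c X → c * (inner (update 0 c X) + inner X) - gap 1 X ≡ gap 0 (update 0 c X)
gap-update₀ c (mkState p r s t) = identity c p r s t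
  where
  identity : ∀ c p r s t →
    c * (((p + c * s) * s + - (r - c * t) * t) + (p * s + - r * t))
    - ((s * (s * 1ℤ) + t * (t * 1ℤ)) - (p * (p * 1ℤ) + - r * (- r * 1ℤ))) ≡
    ((p + c * s) * ((p + c * s) * 1ℤ) + - (r - c * t) * (- (r - c * t) * 1ℤ))
    - (s * (s * 1ℤ) + t * (t * 1ℤ))
  identity = solve-∀

D≡gap : ∀ a m k → D a m k ≡ gap (δ k) (state a m k)
-- The constant a² + 1 - m² is ‖(1, -a)‖² - ‖(0, m)‖².
D≡gap a m zero = identity a m
  where
  identity : ∀ a m → 0ℤ * (1ℤ * 0ℤ + - a * m) + 0ℤ + 1ℤ * (a * (a * 1ℤ) + 1ℤ - m * (m * 1ℤ)) ≡
    (1ℤ * (1ℤ * 1ℤ) + - a * (- a * 1ℤ)) - (0ℤ * (0ℤ * 1ℤ) + m * (m * 1ℤ))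
  identity = solve-∀
D≡gap a m (suc k) = trans
  (trans (D-suc a m k) (cong (λ d → q a m (suc k) * (I a m (suc k) + I a m k) - d) (D≡gap a m k)))
  step
  where
  step : q a m (suc k) * (I a m (suc k) + I a m k) - gap (δ k) (state a m k) ≡
    gap (δ (suc k)) (state a m (suc k))
  step with parity k
  ... | inj₁ (δ≡0 , δ′≡1) rewrite δ≡0 | δ′≡1 = gap-update₁ (quotient 1 (state a m k)) (state a m k)
  ... | inj₂ (δ≡1 , δ′≡0) rewrite δ≡1 | δ′≡0 = gap-update₀ (quotient 0 (state a m k)) (state a m k)

-- Selecting the shortest row by the sign of `D`.

row₁-shortest : ∀ {X} → Valid a m X → ShorterRows a m X →
  ‖ row₁ X ‖² ≤ ‖ row₂ X ‖² → IsShortestNonZero a m (row₁ X)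
row₁-shortest {X = X} V sh = shorter⇒shortest sh (u∈Λ (basis V)) row₁≢0
  where
  row₁≢0 : NonZeroVector (row₁ X)
  row₁≢0 eq = <⇒≢ (suc[i]≤j⇒i<j (1≤x₁₂ V)) (sym (neg-injective {x₁₂ X} {0ℤ} (cong proj₂ eq)))

row₂-shortest : ∀ {X} → Valid a m X → ShorterRows a m X →
  ‖ row₂ X ‖² ≤ ‖ row₁ X ‖² → IsShortestNonZero a m (row₂ X)
row₂-shortest {X = X} V sh = shorter⇒shortest (shorter-swap sh) (w∈Λ (basis V)) row₂≢0
  where
  row₂≢0 : NonZeroVector (row₂ X)
  row₂≢0 eq = <⇒≢ (suc[i]≤j⇒i<j (1≤x₂₂ V)) (sym (cong proj₂ eq))

-- Row 2 - δₖ is the one subtracted in `gap`, and row 1 + δₖ the one it is subtracted from.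
D-selects-shortest : ∀ a m k → Valid a m (state a m k) → ShorterRows a m (state a m k) →
  (D a m k ≥ 0ℤ → IsShortestNonZero a m (v̂ a m (2 ∸ δ k) k))
  × (D a m k ≤ 0ℤ → IsShortestNonZero a m (v̂ a m (1 ℕ.+ δ k) k))
D-selects-shortest a m k V sh rewrite D≡gap a m k with parity k
... | inj₁ (δ≡0 , _) rewrite δ≡0 =
  row₂-shortest V sh ∘ 0≤i-j⇒j≤i , row₁-shortest V sh ∘ i-j≤0⇒i≤j
... | inj₂ (δ≡1 , _) rewrite δ≡1 =
  row₁-shortest V sh ∘ 0≤i-j⇒j≤i , row₂-shortest V sh ∘ i-j≤0⇒i≤j

theorem4p1 : (a m : ℤ) → 1ℤ < a → a < m → gcd a m ≡ 1ℤ →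
    (N : ℕ) → TerminatesAt a m N →
    (k₀ : ℕ) → k₀ ℕ.< N → I a m k₀ < 0ℤ → I a m (suc k₀) ≥ 0ℤ →
    (∣ I a m k₀ ∣ ℕ.≥ ∣ I a m (suc k₀) ∣ →
    (D a m (suc k₀) ≥ 0ℤ → IsShortestNonZero a m (v̂ a m (2 ∸ δ (suc k₀)) (suc k₀)))
    × (D a m (suc k₀) ≤ 0ℤ → IsShortestNonZero a m (v̂ a m (1 ℕ.+ δ (suc k₀)) (suc k₀))))
    × (∣ I a m k₀ ∣ ℕ.≤ ∣ I a m (suc k₀) ∣ →
    (D a m k₀ ≥ 0ℤ → IsShortestNonZero a m (v̂ a m (2 ∸ δ k₀) k₀))
    × (D a m k₀ ≤ 0ℤ → IsShortestNonZero a m (v̂ a m (1 ℕ.+ δ k₀) k₀)))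
theorem4p1 a m 1<a a<m _ _ _ k₀ _ I<0 0≤I′
  with after , before ← crossing-shorter a m 1<a a<m k₀ (<⇒≤ I<0) 0≤I′ =
  (λ ge → D-selects-shortest a m (suc k₀) (state-valid a m 1<a a<m (suc k₀)) (after ge)) ,
  (λ le → D-selects-shortest a m k₀ (state-valid a m 1<a a<m k₀) (before le))
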